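{- Let $d,k\ge 1$ and let $\mathbf{P}=(P_1,\dots,P_k)$ be a collection of lattice polytopes in $\mathbb{R}^d$ such that $P_1+\cdots+P_k$ has dimension $d$. Let $\mathrm{ME}_{\mathbf{P}}(n)=\sum_{i=0}^d \mathrm{me}_i(\mathbf{P})\,n^i$ be the mixed Ehrhart polynomial of $\mathbf{P}$ and let $E_{\mathbf{P}}(n_1,\dots,n_k)=\sum_{\alpha\in\mathbb{Z}_{\ge 0}^k} e_\alpha(\mathbf{P})\, n_1^{\alpha_1}\cdots n_k^{\alpha_k}$ be the multivariate Ehrhart polynomial of $\mathbf{P}$. Then for every $0\le i\le d$ $$\mathrm{me}_i(\mathbf{P})=\sum_{\alpha} e_\alpha(\mathbf{P}),$$ where the sum runs over all $\alpha\in\mathbb{Z}_{\ge 1}^k$ (all entries at least $1$) with $|\alpha|:=\alpha_1+\cdots+\alpha_k=i$. In particular, $\mathrm{me}_i(\mathbf{P})=0$ for all $0\le i<k$.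
   Context: A lattice polytope in $\mathbb{R}^d$ is the convex hull of a nonempty finite subset of $\mathbb{Z}^d$. For $J\subseteq[k]=\{1,\dots,k\}$ put $P_J:=\sum_{j\in J}P_j$ (Minkowski sum), with $P_\emptyset=\{0\}$. For a lattice polytope $P$, $E_P(n)$ is its Ehrhart polynomial, i.e. the polynomial with $E_P(n)=|nP\cap\mathbb{Z}^d|$ for all integers $n\ge 0$. The mixed Ehrhart polynomial of $\mathbf{P}$ is $$\mathrm{ME}_{\mathbf{P}}(n):=\sum_{J\subseteq[k]}(-1)^{k-|J|}E_{P_J}(n)\in\mathbb{Q}[n],$$ a polynomial of degree at most $d$; the coefficient of $n^i$ is denoted $\mathrm{me}_i(\mathbf{P})$. By a theorem of Bernstein and McMullen, the function $(n_1,\dots,n_k)\mapsto |(n_1P_1+\cdots+n_kP_k)\cap\mathbb{Z}^d|$ on $\mathbb{Z}_{\ge 0}^k$ agrees with a (unique) polynomial of total degree at most $d$, denoted $E_{\mathbf{P}}(n_1,\dots,n_k)$; its coefficients are denoted $e_\alpha(\mathbf{P})$. -}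

module Defs where

open import Algebra.Bundles.Raw using (RawMonoid)
import Algebra.Definitions.RawMonoid as RawMonoidDefs
open import Algebra.Definitions.RawSemiring using () renaming (_^_ to pow)
open import Data.Fin.Base using (Fin; zero; suc)
open import Data.Fin.Subset using (Subset; inside; outside; ⊤; ∣_∣)
open import Data.Integer.Base as ℤ using (ℤ; +_)
open import Data.List.Base as List using (List; []; _∷_; _++_)
open import Data.List.Membership.Propositional using (_∈_)
open import Data.List.Relation.Unary.Unique.Propositional using (Unique)
open import Data.Nat.Base as ℕ using (ℕ; zero; suc)
import Data.Nat.Properties as ℕₚ
open import Data.Product.Base using (∃; ∃-syntax; _×_; _,_)
open import Data.Rational.Base as ℚ using (ℚ; 0ℚ; 1ℚ; ½)
import Data.Rational.Properties as ℚₚ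
open import Data.Rational.Solver using (module +-*-Solver)
open import Data.Vec.Base as Vec using (Vec; []; _∷_)
import Data.Vec.Functional as F
open import Data.Vec.Functional using (Vector)
import Data.Vec.Relation.Unary.All as Vecᴬ
open import Function.Bundles using (_⇔_)
open import Level using (0ℓ)
open import Relation.Binary.PropositionalEquality
  using (_≡_; refl; sym; trans; cong; subst)
open import Relation.Nullary using (¬_; _×-dec_)
open import Relation.Unary using (Pred; _≐_)

private
  variable
    d k m : ℕ

-- Real numbers: Cauchy sequences of rationals, taken up to _≈_ (the
-- difference tends to 0).  All operations are termwise.

Cauchy : (ℕ → ℚ) → Set
Cauchy x = ∀ {ε} → 0ℚ ℚ.< ε →
  ∃[ N ] ∀ m n → N ℕ.≤ m → N ℕ.≤ n → ℚ.∣ x m ℚ.- x n ∣ ℚ.< ε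

record ℝ : Set where
  constructor mkℝ
  field
    seq    : ℕ → ℚ
    cauchy : Cauchy seq

open ℝ public

fromℚ : ℚ → ℝ
fromℚ q = mkℝ (λ _ → q) λ {ε} 0<ε →
  0 , λ _ _ _ _ → subst (ℚ._< ε) (sym (cong ℚ.∣_∣ (ℚₚ.+-inverseʳ q))) 0<ε

private
  0<½* : ∀ {ε} → 0ℚ ℚ.< ε → 0ℚ ℚ.< ½ ℚ.* ε
  0<½* {ε} 0<ε =
    subst (ℚ._< ½ ℚ.* ε) (ℚₚ.*-zeroʳ ½) (ℚₚ.*-monoʳ-<-pos ½ 0<ε)

  ½+½ : ∀ ε → ½ ℚ.* ε ℚ.+ ½ ℚ.* ε ≡ ε
  ½+½ ε = trans (sym (ℚₚ.*-distribʳ-+ ε ½ ½)) (ℚₚ.*-identityˡ ε)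

  add-< : ∀ {ε} a b → ℚ.∣ a ∣ ℚ.< ½ ℚ.* ε → ℚ.∣ b ∣ ℚ.< ½ ℚ.* ε →
          ℚ.∣ a ℚ.+ b ∣ ℚ.< ε
  add-< {ε} a b a< b< =
    ℚₚ.≤-<-trans (ℚₚ.∣p+q∣≤∣p∣+∣q∣ a b)
      (subst (_ ℚ.<_) (½+½ ε) (ℚₚ.+-mono-< a< b<))

  ⊔-≤ˡ : ∀ M N {n} → M ℕ.⊔ N ℕ.≤ n → M ℕ.≤ n
  ⊔-≤ˡ M N = ℕₚ.≤-trans (ℕₚ.m≤m⊔n M N)

  ⊔-≤ʳ : ∀ M N {n} → M ℕ.⊔ N ℕ.≤ n → N ℕ.≤ n
  ⊔-≤ʳ M N = ℕₚ.≤-trans (ℕₚ.m≤n⊔m M N)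

infixl 6 _+ʳ_
infixl 7 _*ʳ_

_+ʳ_ : ℝ → ℝ → ℝ
mkℝ x cx +ʳ mkℝ y cy = mkℝ (λ n → x n ℚ.+ y n) c
  where
  open +-*-Solver
  rearrange : ∀ a b c d → (a ℚ.- c) ℚ.+ (b ℚ.- d) ≡ (a ℚ.+ b) ℚ.- (c ℚ.+ d)
  rearrange = solve 4
    (λ a b c d → (a :- c) :+ (b :- d) := (a :+ b) :- (c :+ d)) refl

  c : Cauchy (λ n → x n ℚ.+ y n)
  c {ε} 0<ε with cx (0<½* 0<ε) | cy (0<½* 0<ε)
  ... | M , x< | N , y< = M ℕ.⊔ N , λ m n ≤m ≤n →
    subst (λ z → ℚ.∣ z ∣ ℚ.< ε) (rearrange (x m) (y m) (x n) (y n))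
      (add-< (x m ℚ.- x n) (y m ℚ.- y n)
        (x< m n (⊔-≤ˡ M N ≤m) (⊔-≤ˡ M N ≤n))
        (y< m n (⊔-≤ʳ M N ≤m) (⊔-≤ʳ M N ≤n)))

private
  bounded : ∀ {x} → Cauchy x →
    ∃[ B ] (0ℚ ℚ.< B) × ∃[ N ] ∀ n → N ℕ.≤ n → ℚ.∣ x n ∣ ℚ.≤ B
  bounded {x} cx with cx {1ℚ} (ℚₚ.positive⁻¹ 1ℚ)
  ... | N , x< = B , 0<B , N , bound
    where
    open +-*-Solver
    B : ℚ
    B = 1ℚ ℚ.+ ℚ.∣ x N ∣
    0<B : 0ℚ ℚ.< B
    0<B = ℚₚ.+-mono-<-≤ (ℚₚ.positive⁻¹ 1ℚ) (ℚₚ.0≤∣p∣ (x N))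
    split : ∀ a b → (a ℚ.- b) ℚ.+ b ≡ a
    split = solve 2 (λ a b → (a :- b) :+ b := a) refl
    bound : ∀ n → N ℕ.≤ n → ℚ.∣ x n ∣ ℚ.≤ B
    bound n N≤n = subst (λ z → ℚ.∣ z ∣ ℚ.≤ B) (split (x n) (x N))
      (ℚₚ.≤-trans (ℚₚ.∣p+q∣≤∣p∣+∣q∣ (x n ℚ.- x N) (x N))
        (ℚₚ.+-monoˡ-≤ ℚ.∣ x N ∣ (ℚₚ.<⇒≤ (x< n N N≤n ℕₚ.≤-refl))))

  shrink : ∀ {B} η → 0ℚ ℚ.< B → 0ℚ ℚ.< η →
    ∃[ δ ] (0ℚ ℚ.< δ) × (∀ a b → ℚ.∣ a ∣ ℚ.≤ B → ℚ.∣ b ∣ ℚ.< δ →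
                                  ℚ.∣ a ℚ.* b ∣ ℚ.< η)
  shrink {B} η 0<B 0<η = δ , ℚₚ.positive⁻¹ δ , small
    where
    instance
      B⁺ : ℚ.Positive B
      B⁺ = ℚ.positive 0<B
      η⁺ : ℚ.Positive η
      η⁺ = ℚ.positive 0<η
      B≢0 : ℚ.NonZero B
      B≢0 = ℚₚ.pos⇒nonZero B
      1/B⁺ : ℚ.Positive (ℚ.1/ B)
      1/B⁺ = ℚₚ.1/pos⇒pos B
    δ : ℚ
    δ = ℚ.1/ B ℚ.* η
    instance
      δ⁺ : ℚ.Positive δ
      δ⁺ = ℚₚ.pos*pos⇒pos (ℚ.1/ B) η
    Bδ≡η : B ℚ.* δ ≡ η
    Bδ≡η = trans (sym (ℚₚ.*-assoc B (ℚ.1/ B) η))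
      (trans (cong (ℚ._* η) (ℚₚ.*-inverseʳ B)) (ℚₚ.*-identityˡ η))
    small : ∀ a b → ℚ.∣ a ∣ ℚ.≤ B → ℚ.∣ b ∣ ℚ.< δ → ℚ.∣ a ℚ.* b ∣ ℚ.< η
    small a b a≤ b< = subst (ℚ._< η) (sym (ℚₚ.∣p*q∣≡∣p∣*∣q∣ a b))
      (ℚₚ.≤-<-trans
        (ℚₚ.*-monoʳ-≤-nonNeg ℚ.∣ b ∣ {{ℚₚ.∣-∣-nonNeg b}} a≤)
        (subst (B ℚ.* ℚ.∣ b ∣ ℚ.<_) Bδ≡η (ℚₚ.*-monoʳ-<-pos B b<)))

_*ʳ_ : ℝ → ℝ → ℝ
mkℝ x cx *ʳ mkℝ y cy = mkℝ (λ n → x n ℚ.* y n) c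
  where
  open +-*-Solver
  rearrange : ∀ a b c d →
    a ℚ.* (b ℚ.- d) ℚ.+ d ℚ.* (a ℚ.- c) ≡ a ℚ.* b ℚ.- c ℚ.* d
  rearrange = solve 4
    (λ a b c d → a :* (b :- d) :+ d :* (a :- c) := a :* b :- c :* d) refl

  c : Cauchy (λ n → x n ℚ.* y n)
  c {ε} 0<ε =
    let 0<½ε = 0<½* 0<ε
        Bx , 0<Bx , Nx , x≤ = bounded cx
        By , 0<By , Ny , y≤ = bounded cy
        δ  , 0<δ  , smallˣ  = shrink (½ ℚ.* ε) 0<Bx 0<½ε
        δ′ , 0<δ′ , smallʸ  = shrink (½ ℚ.* ε) 0<By 0<½ε
        My , y< = cy 0<δ
        Mx , x< = cx 0<δ′
        N = Nx ℕ.⊔ Ny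
        M = Mx ℕ.⊔ My
    in N ℕ.⊔ M , λ m n ≤m ≤n →
      subst (λ z → ℚ.∣ z ∣ ℚ.< ε) (rearrange (x m) (y m) (x n) (y n))
        (add-< (x m ℚ.* (y m ℚ.- y n)) (y n ℚ.* (x m ℚ.- x n))
          (smallˣ (x m) (y m ℚ.- y n)
            (x≤ m (⊔-≤ˡ Nx Ny (⊔-≤ˡ N M ≤m)))
            (y< m n (⊔-≤ʳ Mx My (⊔-≤ʳ N M ≤m)) (⊔-≤ʳ Mx My (⊔-≤ʳ N M ≤n))))
          (smallʸ (y n) (x m ℚ.- x n)
            (y≤ n (⊔-≤ʳ Nx Ny (⊔-≤ˡ N M ≤n)))
            (x< m n (⊔-≤ˡ Mx My (⊔-≤ʳ N M ≤m)) (⊔-≤ˡ Mx My (⊔-≤ʳ N M ≤n)))))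

0ℝ 1ℝ : ℝ
0ℝ = fromℚ 0ℚ
1ℝ = fromℚ 1ℚ

fromℤ : ℤ → ℝ
fromℤ z = fromℚ (z ℚ./ 1)

infix 4 _≈_

_≈_ : ℝ → ℝ → Set
x ≈ y = ∀ {ε} → 0ℚ ℚ.< ε →
  ∃[ N ] ∀ n → N ℕ.≤ n → ℚ.∣ seq x n ℚ.- seq y n ∣ ℚ.< ε

NonNegative : ℝ → Set
NonNegative x = ∀ {ε} → 0ℚ ℚ.< ε → ∃[ N ] ∀ n → N ℕ.≤ n → ℚ.- ε ℚ.< seq x n

+-0-rawMonoid : RawMonoid 0ℓ 0ℓ
+-0-rawMonoid = record { Carrier = ℝ ; _≈_ = _≈_ ; _∙_ = _+ʳ_ ; ε = 0ℝ }

open RawMonoidDefs +-0-rawMonoid public using () renaming (sum to ∑)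

Point : ℕ → Set
Point d = Vector ℝ d

infix 4 _≋_

_≋_ : Point d → Point d → Set
x ≋ y = ∀ i → x i ≈ y i

linearCombination : Vector ℝ m → Vector (Point d) m → Point d
linearCombination c p i = ∑ (λ j → c j *ʳ p j i)

fromℤᵈ : Vec ℤ d → Point d
fromℤᵈ z i = fromℤ (Vec.lookup z i)

conv : Vector (Point d) m → Pred (Point d) 0ℓ
conv {m = m} v x = ∃[ c ]
  (∀ (j : Fin m) → NonNegative (c j)) × (∑ c ≈ 1ℝ) × (x ≋ linearCombination c v)

-- A nonempty finite subset of ℤᵈ is given as the range of a family
-- indexed by Fin (suc m).
IsLatticePolytope : Pred (Point d) 0ℓ → Set
IsLatticePolytope {d} S =
  ∃[ m ] ∃ λ (v : Vector (Vec ℤ d) (suc m)) → S ≐ conv (F.map fromℤᵈ v)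

infixl 6 _⊕_
infixr 7 _•_

_⊕_ : Pred (Point d) 0ℓ → Pred (Point d) 0ℓ → Pred (Point d) 0ℓ
(S ⊕ T) x = ∃[ s ] ∃[ t ] S s × T t × (x ≋ λ i → s i +ʳ t i)

_•_ : ℕ → Pred (Point d) 0ℓ → Pred (Point d) 0ℓ
(n • S) x = ∃[ s ] S s × (x ≋ λ i → fromℤ (+ n) *ʳ s i)

-- P_J = Σ_{j ∈ J} P_j, the empty sum being {0}.
minkowskiSum : Subset k → Vector (Pred (Point d) 0ℓ) k → Pred (Point d) 0ℓ
minkowskiSum []            P x = x ≋ λ _ → 0ℝ
minkowskiSum (inside  ∷ J) P   = F.head P ⊕ minkowskiSum J (F.tail P)
minkowskiSum (outside ∷ J) P   = minkowskiSum J (F.tail P)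

AffinelyIndependent : Vector (Point d) m → Set
AffinelyIndependent p = ∀ c →
  ∑ c ≈ 0ℝ → linearCombination c p ≋ (λ _ → 0ℝ) → ∀ j → c j ≈ 0ℝ

-- The dimension is one less than the largest size of an affinely
-- independent family in the set.
HasDimension : Pred (Point d) 0ℓ → ℕ → Set
HasDimension {d} S m =
  (∃ λ (p : Vector (Point d) (suc m)) → (∀ j → S (p j)) × AffinelyIndependent p) ×
  (∀ (p : Vector (Point d) (suc (suc m))) → (∀ j → S (p j)) → ¬ AffinelyIndependent p)

HasCardinality : {A : Set} → Pred A 0ℓ → ℕ → Set
HasCardinality {A} S c = ∃ λ (xs : List A) →
  Unique xs × (∀ x → x ∈ xs ⇔ S x) × List.length xs ≡ c

latticePoints : Pred (Point d) 0ℓ → Pred (Vec ℤ d) 0ℓ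
latticePoints S z = S (fromℤᵈ z)

-- Polynomials over ℚ in k variables, as ℚ[x₂,…,x_k][x₁]:
-- p +X* q stands for p + x₁ q, where p does not involve x₁.

infixr 6 _+X*_

data Polynomial : ℕ → Set where
  con   : ℚ → Polynomial zero
  0ᴾ    : Polynomial (suc k)
  _+X*_ : Polynomial k → Polynomial (suc k) → Polynomial (suc k)

eval : Polynomial k → Vec ℚ k → ℚ
eval (con q)   []       = q
eval 0ᴾ        (x ∷ xs) = 0ℚ
eval (p +X* q) (x ∷ xs) = eval p xs ℚ.+ x ℚ.* eval q (x ∷ xs)

-- coeff p α is the coefficient of x₁^α₁ ⋯ x_k^α_k.
coeff : Polynomial k → Vec ℕ k → ℚ
coeff (con q)   []          = q
coeff 0ᴾ        (_ ∷ _)     = 0ℚ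
coeff (p +X* q) (zero  ∷ α) = coeff p α
coeff (p +X* q) (suc a ∷ α) = coeff q (a ∷ α)

infixl 6 _+ᴾ_
infixr 7 _*ᴾ_

_+ᴾ_ : Polynomial k → Polynomial k → Polynomial k
con a     +ᴾ con b       = con (a ℚ.+ b)
0ᴾ        +ᴾ q           = q
(p +X* q) +ᴾ 0ᴾ          = p +X* q
(p +X* q) +ᴾ (p′ +X* q′) = (p +ᴾ p′) +X* (q +ᴾ q′)

_*ᴾ_ : ℚ → Polynomial k → Polynomial k
c *ᴾ con a     = con (c ℚ.* a)
c *ᴾ 0ᴾ        = 0ᴾ
c *ᴾ (p +X* q) = (c *ᴾ p) +X* (c *ᴾ q)

TotalDegree≤ : ℕ → Polynomial k → Set
TotalDegree≤ D p = ∀ α → D ℕ.< Vec.sum α → coeff p α ≡ 0ℚ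

fromℕ : ℕ → ℚ
fromℕ n = + n ℚ./ 1

IsEhrhartPolynomial : Pred (Point d) 0ℓ → Polynomial 1 → Set
IsEhrhartPolynomial S E = ∀ n →
  ∃[ c ] HasCardinality (latticePoints (n • S)) c × eval E (fromℕ n ∷ []) ≡ fromℕ c

record IsMultivariateEhrhartPolynomial
         (P : Vector (Pred (Point d) 0ℓ) k) (E : Polynomial k) : Set where
  field
    counts : ∀ (n : Vec ℕ k) → ∃[ c ]
      HasCardinality (latticePoints (minkowskiSum ⊤ (λ j → Vec.lookup n j • P j))) c
      × eval E (Vec.map fromℕ n) ≡ fromℕ c
    degree : TotalDegree≤ d E

subsets : ∀ k → List (Subset k)
subsets zero    = [] ∷ []
subsets (suc k) =
  List.map (outside ∷_) (subsets k) ++ List.map (inside ∷_) (subsets k)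

-- Σ_{J ⊆ [k]} (-1)^{k-|J|} E_J, where E J is meant to be the Ehrhart
-- polynomial of P_J.
mixedEhrhartPolynomial : (Subset k → Polynomial 1) → Polynomial 1
mixedEhrhartPolynomial {k} E = List.foldr _+ᴾ_ 0ᴾ
  (List.map (λ J → pow ℚ.+-*-rawSemiring (ℚ.- 1ℚ) (k ℕ.∸ ∣ J ∣) *ᴾ E J) (subsets k))

sumℚ : List ℚ → ℚ
sumℚ = List.foldr ℚ._+_ 0ℚ

box : ∀ k → ℕ → List (Vec ℕ k)
box zero    N = [] ∷ []
box (suc k) N = List.cartesianProductWith _∷_ (List.upTo (suc N)) (box k N)

-- The α ∈ ℤ≥1ᵏ with |α| = i; every entry of such an α is at most i.
compositions : ∀ k → ℕ → List (Vec ℕ k)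
compositions k i = List.filter
  (λ α → Vecᴬ.all? (1 ℕₚ.≤?_) α ×-dec (Vec.sum α ℕₚ.≟ i)) (box k i)

{-# OPTIONS --safe #-}

-- For J ⊆ [k] the dilate n P_J is the Minkowski sum of the n_j P_j at the vector
-- n·1_J, so E_{P_J}(n) = E_P(n·1_J).  A monomial x^α evaluates at n·1_J to n^|α|
-- if the support of α lies in J and to 0 otherwise; in the alternating sum over J
-- only the α with full support survive.  Two univariate polynomials that
-- agree on ℕ have the same coefficients, which gives the formula, and an α with
-- full support has |α| ≥ k.
module Submission where

open import Defs
open import Data.Fin.Subset using (Subset; ⊤)
open import Data.List.Base using (map)
open import Data.Nat.Base using (ℕ; _≤_; _<_)
open import Data.Product.Base using (_×_)
open import Data.Rational.Base using (0ℚ)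
open import Data.Vec.Base using ([]; _∷_)
open import Data.Vec.Functional using (Vector)
open import Level using (0ℓ)
open import Relation.Binary.PropositionalEquality using (_≡_)
open import Relation.Unary using (Pred)

open import Algebra.Definitions.RawSemiring using () renaming (_^_ to pow)
open import Data.Bool.Base using (if_then_else_; true; false)
import Data.Bool.Properties as Boolₚ
open import Data.Fin.Base using (zero; suc)
open import Data.Fin.Subset using (inside; outside; ∣_∣)
open import Data.Fin.Subset.Properties using (∣p∣≤n)
open import Data.Integer.Base as ℤ using (ℤ; +_)
open import Data.List.Base as List using (List; []; _∷_; _++_)
import Data.List.Properties as Listₚ
open import Data.List.Membership.Propositional.Properties.WithK using (unique∧set⇒bag)
open import Data.List.Relation.Binary.BagAndSetEquality using (∼bag⇒↭)
open import Data.List.Relation.Binary.Permutation.Propositional.Properties using (↭-length)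
open import Data.Nat.Base as ℕ using (zero; suc; s≤s)
import Data.Integer.Properties as ℤₚ
import Data.Nat.Properties as ℕₚ
open import Data.Product.Base using (∃; ∃-syntax; _,_; proj₁; proj₂)
open import Data.Rational.Base as ℚ using (ℚ; 1ℚ; ½)
import Data.Rational.Properties as ℚₚ
open import Data.Rational.Solver using (module +-*-Solver)
open import Data.Rational.Unnormalised.Base using (mkℚᵘ; *≡*)
open import Data.Vec.Base as Vec using (Vec)
import Data.Vec.Functional as F
import Data.Vec.Relation.Unary.All as Vecᴬ
open import Function.Base using (_∘_)
open import Function.Bundles using (_⇔_; mk⇔)
import Function.Properties.Equivalence as ⇔
open import Relation.Binary.PropositionalEquality
  using (refl; sym; trans; cong; cong₂; subst; _≢_; module ≡-Reasoning)
open import Relation.Nullary using (Dec; does; _×-dec_)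
open import Relation.Unary using (Decidable)

open +-*-Solver using (solve; _:=_; _:+_; _:*_; _:-_; :-_; con)

private
  variable
    d k : ℕ
    A B : Set

-- Sequences tending to 0

-- `x ≈ y` unfolds to `Null` of the termwise difference, so equalities of reals become statements
-- about null sequences.
Null : (ℕ → ℚ) → Set
Null s = ∀ {ε} → 0ℚ ℚ.< ε → ∃[ N ] ∀ n → N ≤ n → ℚ.∣ s n ∣ ℚ.< ε

null-resp : ∀ s t → (∀ n → s n ≡ t n) → Null s → Null t
null-resp s t s≗t s→0 {ε} 0<ε with s→0 0<ε
... | N , s< = N , λ n N≤n → subst (λ z → ℚ.∣ z ∣ ℚ.< ε) (s≗t n) (s< n N≤n)

null-0 : Null (λ _ → 0ℚ)
null-0 0<ε = 0 , λ _ _ → 0<ε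

null-+ : ∀ s t → Null s → Null t → Null (λ n → s n ℚ.+ t n)
null-+ s t s→0 t→0 {ε} 0<ε with s→0 0<½ε | t→0 0<½ε
  where
  0<½ε : 0ℚ ℚ.< ½ ℚ.* ε
  0<½ε = subst (ℚ._< ½ ℚ.* ε) (ℚₚ.*-zeroʳ ½) (ℚₚ.*-monoʳ-<-pos ½ 0<ε)
... | M , s< | N , t< = M ℕ.⊔ N , λ n ≤n →
  ℚₚ.≤-<-trans (ℚₚ.∣p+q∣≤∣p∣+∣q∣ (s n) (t n))
    (subst (ℚ.∣ s n ∣ ℚ.+ ℚ.∣ t n ∣ ℚ.<_) halves
      (ℚₚ.+-mono-< (s< n (ℕₚ.≤-trans (ℕₚ.m≤m⊔n M N) ≤n))
                   (t< n (ℕₚ.≤-trans (ℕₚ.m≤n⊔m M N) ≤n))))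
  where
  halves : ½ ℚ.* ε ℚ.+ ½ ℚ.* ε ≡ ε
  halves = trans (sym (ℚₚ.*-distribʳ-+ ε ½ ½)) (ℚₚ.*-identityˡ ε)

null-* : ∀ q s → Null s → Null (λ n → q ℚ.* s n)
null-* q s s→0 {ε} 0<ε = N , λ n N≤n →
  subst (ℚ._< ε) (sym (ℚₚ.∣p*q∣≡∣p∣*∣q∣ q (s n)))
    (ℚₚ.≤-<-trans
      (ℚₚ.*-monoʳ-≤-nonNeg ℚ.∣ s n ∣ {{ℚₚ.∣-∣-nonNeg (s n)}} ∣q∣≤b)
      (subst (b ℚ.* ℚ.∣ s n ∣ ℚ.<_) bδ≡ε (ℚₚ.*-monoʳ-<-pos b (s< n N≤n))))
  where
  -- Adding 1 keeps the bound positive, hence invertible, even when `q` is 0.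
  b : ℚ
  b = 1ℚ ℚ.+ ℚ.∣ q ∣
  instance
    b⁺ : ℚ.Positive b
    b⁺ = ℚ.positive (ℚₚ.+-mono-<-≤ (ℚₚ.positive⁻¹ 1ℚ) (ℚₚ.0≤∣p∣ q))
    ε⁺ : ℚ.Positive ε
    ε⁺ = ℚ.positive 0<ε
    b≢0 : ℚ.NonZero b
    b≢0 = ℚₚ.pos⇒nonZero b
    1/b⁺ : ℚ.Positive (ℚ.1/ b)
    1/b⁺ = ℚₚ.1/pos⇒pos b
  ∣q∣≤b : ℚ.∣ q ∣ ℚ.≤ b
  ∣q∣≤b = subst (ℚ._≤ b) (ℚₚ.+-identityˡ ℚ.∣ q ∣)
    (ℚₚ.+-monoˡ-≤ ℚ.∣ q ∣ (ℚₚ.<⇒≤ (ℚₚ.positive⁻¹ 1ℚ)))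
  δ : ℚ
  δ = ℚ.1/ b ℚ.* ε
  bδ≡ε : b ℚ.* δ ≡ ε
  bδ≡ε = trans (sym (ℚₚ.*-assoc b (ℚ.1/ b) ε))
    (trans (cong (ℚ._* ε) (ℚₚ.*-inverseʳ b)) (ℚₚ.*-identityˡ ε))
  small : ∃[ N ] ∀ n → N ≤ n → ℚ.∣ s n ∣ ℚ.< δ
  small = s→0 (ℚₚ.positive⁻¹ δ {{ℚₚ.pos*pos⇒pos (ℚ.1/ b) ε}})
  N = proj₁ small
  s< = proj₂ small

≋-refl : (x : Point d) → x ≋ x
≋-refl x i = null-resp (λ _ → 0ℚ) (λ n → seq (x i) n ℚ.- seq (x i) n)
  (λ n → sym (ℚₚ.+-inverseʳ (seq (x i) n))) null-0

≋-trans : (x y z : Point d) → x ≋ y → y ≋ z → x ≋ z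
≋-trans x y z x≋y y≋z i = null-resp
  (λ n → (seq (x i) n ℚ.- seq (y i) n) ℚ.+ (seq (y i) n ℚ.- seq (z i) n))
  (λ n → seq (x i) n ℚ.- seq (z i) n)
  (λ n → solve 3 (λ a b c → (a :- b) :+ (b :- c) := a :- c) refl
    (seq (x i) n) (seq (y i) n) (seq (z i) n))
  (null-+ (λ n → seq (x i) n ℚ.- seq (y i) n) (λ n → seq (y i) n ℚ.- seq (z i) n)
    (x≋y i) (y≋z i))

-- Dilates of Minkowski sums

infixl 6 _+ᵛ_
infixr 7 _*ᵛ_

_+ᵛ_ : Point d → Point d → Point d
(x +ᵛ y) i = x i +ʳ y i

_*ᵛ_ : ℕ → Point d → Point d
(n *ᵛ x) i = fromℤ (+ n) *ʳ x i

*ᵛ-cong : ∀ n (x y : Point d) → x ≋ y → n *ᵛ x ≋ n *ᵛ y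
*ᵛ-cong n x y x≋y i = null-resp
  (λ m → fromℕ n ℚ.* (seq (x i) m ℚ.- seq (y i) m))
  (λ m → fromℕ n ℚ.* seq (x i) m ℚ.- fromℕ n ℚ.* seq (y i) m)
  (λ m → solve 3 (λ q a b → q :* (a :- b) := q :* a :- q :* b) refl
    (fromℕ n) (seq (x i) m) (seq (y i) m))
  (null-* (fromℕ n) (λ m → seq (x i) m ℚ.- seq (y i) m) (x≋y i))

+ᵛ-cong : (x y u v : Point d) → x ≋ y → u ≋ v → x +ᵛ u ≋ y +ᵛ v
+ᵛ-cong x y u v x≋y u≋v i = null-resp
  (λ m → (seq (x i) m ℚ.- seq (y i) m) ℚ.+ (seq (u i) m ℚ.- seq (v i) m))
  (λ m → (seq (x i) m ℚ.+ seq (u i) m) ℚ.- (seq (y i) m ℚ.+ seq (v i) m))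
  (λ m → solve 4 (λ a b c e → (a :- b) :+ (c :- e) := (a :+ c) :- (b :+ e)) refl
    (seq (x i) m) (seq (y i) m) (seq (u i) m) (seq (v i) m))
  (null-+ (λ m → seq (x i) m ℚ.- seq (y i) m) (λ m → seq (u i) m ℚ.- seq (v i) m)
    (x≋y i) (u≋v i))

≗⇒≋ : (x y : Point d) → (∀ i n → seq (x i) n ≡ seq (y i) n) → x ≋ y
≗⇒≋ x y x≗y i = null-resp
  (λ n → seq (x i) n ℚ.- seq (x i) n) (λ n → seq (x i) n ℚ.- seq (y i) n)
  (λ n → cong (λ z → seq (x i) n ℚ.- z) (x≗y i n)) (≋-refl x i)

0ᵛ : Point d
0ᵛ _ = 0ℝ

*ᵛ-zeroʳ : ∀ n → n *ᵛ 0ᵛ {d} ≋ 0ᵛ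
*ᵛ-zeroʳ n = ≗⇒≋ (n *ᵛ 0ᵛ) 0ᵛ λ _ _ → ℚₚ.*-zeroʳ (fromℕ n)

*ᵛ-zeroʳ⁻ : ∀ n → 0ᵛ {d} ≋ n *ᵛ 0ᵛ
*ᵛ-zeroʳ⁻ n = ≗⇒≋ 0ᵛ (n *ᵛ 0ᵛ) λ _ _ → sym (ℚₚ.*-zeroʳ (fromℕ n))

*ᵛ-distribˡ : ∀ n (x y : Point d) → n *ᵛ (x +ᵛ y) ≋ n *ᵛ x +ᵛ n *ᵛ y
*ᵛ-distribˡ n x y = ≗⇒≋ (n *ᵛ (x +ᵛ y)) (n *ᵛ x +ᵛ n *ᵛ y)
  λ i m → ℚₚ.*-distribˡ-+ (fromℕ n) (seq (x i) m) (seq (y i) m)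

*ᵛ-distribˡ⁻ : ∀ n (x y : Point d) → n *ᵛ x +ᵛ n *ᵛ y ≋ n *ᵛ (x +ᵛ y)
*ᵛ-distribˡ⁻ n x y = ≗⇒≋ (n *ᵛ x +ᵛ n *ᵛ y) (n *ᵛ (x +ᵛ y))
  λ i m → sym (ℚₚ.*-distribˡ-+ (fromℕ n) (seq (x i) m) (seq (y i) m))

+ᵛ-identityˡ : (p x : Point d) → 0 *ᵛ p +ᵛ x ≋ x
+ᵛ-identityˡ p x = ≗⇒≋ (0 *ᵛ p +ᵛ x) x λ i n →
  trans (cong (ℚ._+ seq (x i) n) (ℚₚ.*-zeroˡ (seq (p i) n))) (ℚₚ.+-identityˡ _)

+ᵛ-identityˡ⁻ : (p x : Point d) → x ≋ 0 *ᵛ p +ᵛ x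
+ᵛ-identityˡ⁻ p x = ≗⇒≋ x (0 *ᵛ p +ᵛ x) λ i n → sym
  (trans (cong (ℚ._+ seq (x i) n) (ℚₚ.*-zeroˡ (seq (p i) n))) (ℚₚ.+-identityˡ _))

-- The vector x·1_J. The value `o` off J is a parameter so that the same function serves over `ℕ`
-- and over `ℚ`.
at : A → A → Subset k → Vec A k
at o x = Vec.map (if_then x else o)

-- For j outside J the right-hand side still has the summand 0·P_j, which is {0} only if P_j has a
-- point; hence the nonemptiness assumption. For j in J the factor `n` distributes over the sum.
dilate-sum⁺ : ∀ n (J : Subset k) (P : Vector (Pred (Point d) 0ℓ) k) →
  (∀ j → ∃ (P j)) → ∀ x → (n • minkowskiSum J P) x →
  minkowskiSum ⊤ (λ j → Vec.lookup (at 0 n J) j • P j) x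
dilate-sum⁺ n [] P ne x (u , u≋0 , x≋nu) =
  ≋-trans x (n *ᵛ u) 0ᵛ x≋nu
    (≋-trans (n *ᵛ u) (n *ᵛ 0ᵛ) 0ᵛ (*ᵛ-cong n u 0ᵛ u≋0) (*ᵛ-zeroʳ n))
dilate-sum⁺ n (outside ∷ J) P ne x x∈ =
  let p , p∈ = ne zero
  in 0 *ᵛ p , x , (p , p∈ , ≋-refl (0 *ᵛ p))
   , dilate-sum⁺ n J (F.tail P) (ne ∘ suc) x x∈ , +ᵛ-identityˡ⁻ p x
dilate-sum⁺ n (inside ∷ J) P ne x (u , (s , t , s∈ , t∈ , u≋s+t) , x≋nu) =
  n *ᵛ s , n *ᵛ t , (s , s∈ , ≋-refl (n *ᵛ s))
  , dilate-sum⁺ n J (F.tail P) (ne ∘ suc) (n *ᵛ t) (t , t∈ , ≋-refl (n *ᵛ t))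
  , ≋-trans x (n *ᵛ u) (n *ᵛ s +ᵛ n *ᵛ t) x≋nu
      (≋-trans (n *ᵛ u) (n *ᵛ (s +ᵛ t)) (n *ᵛ s +ᵛ n *ᵛ t)
        (*ᵛ-cong n u (s +ᵛ t) u≋s+t) (*ᵛ-distribˡ n s t))

-- The summands over J all carry the same factor `n`, which is pulled out; a summand outside J is 0
-- times a point and is absorbed.
dilate-sum⁻ : ∀ n (J : Subset k) (P : Vector (Pred (Point d) 0ℓ) k) → ∀ x →
  minkowskiSum ⊤ (λ j → Vec.lookup (at 0 n J) j • P j) x →
  (n • minkowskiSum J P) x
dilate-sum⁻ n [] P x x≋0 =
  0ᵛ , ≋-refl 0ᵛ , ≋-trans x 0ᵛ (n *ᵛ 0ᵛ) x≋0 (*ᵛ-zeroʳ⁻ n)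
dilate-sum⁻ n (outside ∷ J) P x (s , t , (p , p∈ , s≋0p) , t∈ , x≋s+t) =
  let u , u∈ , t≋nu = dilate-sum⁻ n J (F.tail P) t t∈
  in u , u∈
   , ≋-trans x (s +ᵛ t) (n *ᵛ u) x≋s+t
       (≋-trans (s +ᵛ t) (0 *ᵛ p +ᵛ n *ᵛ u) (n *ᵛ u)
         (+ᵛ-cong s (0 *ᵛ p) t (n *ᵛ u) s≋0p t≋nu) (+ᵛ-identityˡ p (n *ᵛ u)))
dilate-sum⁻ n (inside ∷ J) P x (s , t , (p , p∈ , s≋np) , t∈ , x≋s+t) =
  let u , u∈ , t≋nu = dilate-sum⁻ n J (F.tail P) t t∈
  in p +ᵛ u , (p , u , p∈ , u∈ , ≋-refl (p +ᵛ u))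
   , ≋-trans x (s +ᵛ t) (n *ᵛ (p +ᵛ u)) x≋s+t
       (≋-trans (s +ᵛ t) (n *ᵛ p +ᵛ n *ᵛ u) (n *ᵛ (p +ᵛ u))
         (+ᵛ-cong s (n *ᵛ p) t (n *ᵛ u) s≋np t≋nu) (*ᵛ-distribˡ⁻ n p u))

-- Nonemptiness of lattice polytopes and uniqueness of cardinalities

∑-0 : ∀ m → seq (∑ {m} (λ _ → 0ℝ)) ≡ λ _ → 0ℚ
∑-0 zero    = refl
∑-0 (suc m) = cong (λ s n → 0ℚ ℚ.+ s n) (∑-0 m)

polytope-nonempty : (S : Pred (Point d) 0ℓ) → IsLatticePolytope S → ∃ S
polytope-nonempty {d} S (m , v , _ , conv⊆S) =
  x , conv⊆S {x} (c , c≥0 , ∑c≈1 , ≋-refl x)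
  where
  -- The weights 1, 0, ..., 0 single out the first of the `suc m` generators. The point is left as
  -- the combination itself, so that membership in the hull ends in reflexivity.
  c : Vector ℝ (suc m)
  c zero    = 1ℝ
  c (suc _) = 0ℝ
  x : Point d
  x = linearCombination c (F.map fromℤᵈ v)
  ∑c≈1 : ∑ c ≈ 1ℝ
  ∑c≈1 = null-resp (λ _ → 0ℚ) (λ n → seq (∑ c) n ℚ.- 1ℚ)
    (λ n → cong (λ s → (1ℚ ℚ.+ s n) ℚ.- 1ℚ) (sym (∑-0 m))) null-0
  c≥0 : ∀ j → NonNegative (c j)
  c≥0 zero    0<ε = 0 , λ _ _ →
    ℚₚ.<-trans (ℚₚ.neg-antimono-< 0<ε) (ℚₚ.positive⁻¹ 1ℚ)
  c≥0 (suc _) 0<ε = 0 , λ _ _ → ℚₚ.neg-antimono-< 0<ε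

-- Duplicate-free lists with the same members are equal as bags, hence permutations of each other,
-- hence equally long.
cardinality-unique : {S T : Pred A 0ℓ} {a b : ℕ} → (∀ x → S x ⇔ T x) →
  HasCardinality S a → HasCardinality T b → a ≡ b
cardinality-unique S⇔T (xs , xs! , ∈xs , a) (ys , ys! , ∈ys , b) =
  trans (sym a) (trans
    (↭-length (∼bag⇒↭ (unique∧set⇒bag xs! ys! λ {x} →
      ⇔.trans (∈xs x) (⇔.trans (S⇔T x) (⇔.sym (∈ys x))))))
    b)

-- Univariate polynomials

eval-+ᴾ : ∀ (p q : Polynomial k) x → eval (p +ᴾ q) x ≡ eval p x ℚ.+ eval q x
eval-+ᴾ (con a)   (con b)     []       = refl
eval-+ᴾ 0ᴾ        q           (x ∷ xs) = sym (ℚₚ.+-identityˡ _)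
eval-+ᴾ (p +X* q) 0ᴾ          (x ∷ xs) = sym (ℚₚ.+-identityʳ _)
eval-+ᴾ (p +X* q) (p′ +X* q′) (x ∷ xs) =
  trans (cong₂ (λ a b → a ℚ.+ x ℚ.* b) (eval-+ᴾ p p′ xs) (eval-+ᴾ q q′ (x ∷ xs)))
    (solve 5 (λ a a′ x b b′ →
        (a :+ a′) :+ x :* (b :+ b′) := (a :+ x :* b) :+ (a′ :+ x :* b′)) refl
      (eval p xs) (eval p′ xs) x (eval q (x ∷ xs)) (eval q′ (x ∷ xs)))

eval-*ᴾ : ∀ c (p : Polynomial k) x → eval (c *ᴾ p) x ≡ c ℚ.* eval p x
eval-*ᴾ c (con a)   []       = refl
eval-*ᴾ c 0ᴾ        (x ∷ xs) = sym (ℚₚ.*-zeroʳ c)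
eval-*ᴾ c (p +X* q) (x ∷ xs) =
  trans (cong₂ (λ a b → a ℚ.+ x ℚ.* b) (eval-*ᴾ c p xs) (eval-*ᴾ c q (x ∷ xs)))
    (solve 4 (λ c a x b → c :* a :+ x :* (c :* b) := c :* (a :+ x :* b)) refl
      c (eval p xs) x (eval q (x ∷ xs)))

coeff-+ᴾ : ∀ (p q : Polynomial k) α → coeff (p +ᴾ q) α ≡ coeff p α ℚ.+ coeff q α
coeff-+ᴾ (con a)   (con b)     []          = refl
coeff-+ᴾ 0ᴾ        q           (_ ∷ _)     = sym (ℚₚ.+-identityˡ _)
coeff-+ᴾ (p +X* q) 0ᴾ          (_ ∷ _)     = sym (ℚₚ.+-identityʳ _)
coeff-+ᴾ (p +X* q) (p′ +X* q′) (zero  ∷ α) = coeff-+ᴾ p p′ α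
coeff-+ᴾ (p +X* q) (p′ +X* q′) (suc a ∷ α) = coeff-+ᴾ q q′ (a ∷ α)

coeff-*ᴾ : ∀ c (p : Polynomial k) α → coeff (c *ᴾ p) α ≡ c ℚ.* coeff p α
coeff-*ᴾ c (con a)   []          = refl
coeff-*ᴾ c 0ᴾ        (_ ∷ _)     = sym (ℚₚ.*-zeroʳ c)
coeff-*ᴾ c (p +X* q) (zero  ∷ α) = coeff-*ᴾ c p α
coeff-*ᴾ c (p +X* q) (suc a ∷ α) = coeff-*ᴾ c q (a ∷ α)

-- quotient c q is the quotient of a + x q by x - c, for any constant a.
quotient : ℚ → Polynomial 1 → Polynomial 1
quotient c 0ᴾ        = 0ᴾ
quotient c (b +X* q) = con (eval (b +X* q) (c ∷ [])) +X* quotient c q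

-- Horner's scheme: the coefficients of the quotient are partial values at `c`, and x q leaves the
-- remainder c q(c). The constant `a` is left out because it cancels in p(x) - p(c).
eval-quotient : ∀ c q x → x ℚ.* eval q (x ∷ []) ≡
  (x ℚ.- c) ℚ.* eval (quotient c q) (x ∷ []) ℚ.+ c ℚ.* eval q (c ∷ [])
eval-quotient c 0ᴾ x =
  solve 2 (λ x c → x :* con 0ℚ := (x :- c) :* con 0ℚ :+ c :* con 0ℚ) refl x c
eval-quotient c (con b +X* q) x = trans
  (cong (λ z → x ℚ.* (b ℚ.+ z)) (eval-quotient c q x))
  (solve 5 (λ x c b r e →
      x :* (b :+ ((x :- c) :* r :+ c :* e)) :=
      (x :- c) :* ((b :+ c :* e) :+ x :* r) :+ c :* (b :+ c :* e)) refl
    x c b (eval (quotient c q) (x ∷ [])) (eval q (c ∷ [])))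

coeff₀-quotient : ∀ c q → coeff (quotient c q) (0 ∷ []) ≡ eval q (c ∷ [])
coeff₀-quotient c 0ᴾ       = refl
coeff₀-quotient c (_ +X* _) = refl

-- The recurrence of synthetic division. Read backwards, it recovers `q` from the quotient, so that
-- `q` has zero coefficients as soon as the quotient has.
coeff-quotient : ∀ c q i →
  coeff (quotient c q) (i ∷ []) ≡
  coeff q (i ∷ []) ℚ.+ c ℚ.* coeff (quotient c q) (suc i ∷ [])
coeff-quotient c 0ᴾ i = sym (trans (ℚₚ.+-identityˡ _) (ℚₚ.*-zeroʳ c))
coeff-quotient c (con b +X* q) zero =
  cong (λ z → b ℚ.+ c ℚ.* z) (sym (coeff₀-quotient c q))
coeff-quotient c (con b +X* q) (suc i) = coeff-quotient c q i

-- The number of listed coefficients, zero ones included, replaces the degree as induction measure: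
-- the quotient is not a subterm of a + x q, but it is one shorter.
length : Polynomial 1 → ℕ
length 0ᴾ       = 0
length (_ +X* q) = suc (length q)

length-quotient : ∀ c q → length (quotient c q) ≡ length q
length-quotient c 0ᴾ       = refl
length-quotient c (_ +X* q) = cong suc (length-quotient c q)

fromℕ-injective : ∀ {m n} → fromℕ m ≡ fromℕ n → m ≡ n
fromℕ-injective {m} {n} eq
  -- `mkℚᵘ` takes the denominator minus one, so the `0` stands for denominator 1.
  with *≡* e ← ℚₚ.fromℚᵘ-injective {mkℚᵘ (+ m) 0} {mkℚᵘ (+ n) 0} eq =
  ℤₚ.+-injective (ℤₚ.*-cancelʳ-≡ (+ m) (+ n) (+ 1) e)

p*q≡0⇒q≡0 : ∀ p q → p ≢ 0ℚ → p ℚ.* q ≡ 0ℚ → q ≡ 0ℚ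
p*q≡0⇒q≡0 p q p≢0 pq≡0 = begin
  q                       ≡⟨ ℚₚ.*-identityˡ q ⟨
  1ℚ ℚ.* q                ≡⟨ cong (ℚ._* q) (ℚₚ.*-inverseˡ p) ⟨
  ℚ.1/ p ℚ.* p ℚ.* q      ≡⟨ ℚₚ.*-assoc (ℚ.1/ p) p q ⟩
  ℚ.1/ p ℚ.* (p ℚ.* q)    ≡⟨ cong (ℚ.1/ p ℚ.*_) pq≡0 ⟩
  ℚ.1/ p ℚ.* 0ℚ           ≡⟨ ℚₚ.*-zeroʳ (ℚ.1/ p) ⟩
  0ℚ                      ∎
  where
  open ≡-Reasoning
  instance
    p-nonZero : ℚ.NonZero p
    p-nonZero = ℚ.≢-nonZero p≢0

p-q≡0⇒p≡q : ∀ p q → p ℚ.- q ≡ 0ℚ → p ≡ q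
p-q≡0⇒p≡q p q eq = trans (solve 2 (λ p q → p := (p :- q) :+ q) refl p q)
  (trans (cong (ℚ._+ q) eq) (ℚₚ.+-identityˡ q))

-- If a + x q vanishes at N then it is (x - N) times the quotient, which therefore
-- vanishes at all n > N.
eventually-zero⇒coeff≡0 : ∀ m p → length p ≤ m → ∀ N →
  (∀ n → N ≤ n → eval p (fromℕ n ∷ []) ≡ 0ℚ) → ∀ i → coeff p (i ∷ []) ≡ 0ℚ
eventually-zero⇒coeff≡0 m 0ᴾ _ N _ i = refl
eventually-zero⇒coeff≡0 (suc m) (con a +X* q) (s≤s q≤m) N p≡0 = coeff-p≡0
  where
  open ≡-Reasoning
  c = fromℕ N
  r = quotient c q

  r≡0 : ∀ n → suc N ≤ n → eval r (fromℕ n ∷ []) ≡ 0ℚ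
  r≡0 n N<n = p*q≡0⇒q≡0 (x ℚ.- c) (eval r (x ∷ []))
    (λ eq → ℕₚ.<⇒≢ N<n (sym (fromℕ-injective (p-q≡0⇒p≡q x c eq)))) (begin
      (x ℚ.- c) ℚ.* R
        ≡⟨ solve 3 (λ a s t → s := (a :+ (s :+ t)) :- (a :+ t)) refl
             a ((x ℚ.- c) ℚ.* R) (c ℚ.* Q) ⟩
      (a ℚ.+ ((x ℚ.- c) ℚ.* R ℚ.+ c ℚ.* Q)) ℚ.- (a ℚ.+ c ℚ.* Q)
        ≡⟨ cong (λ z → (a ℚ.+ z) ℚ.- (a ℚ.+ c ℚ.* Q)) (eval-quotient c q x) ⟨
      (a ℚ.+ x ℚ.* eval q (x ∷ [])) ℚ.- (a ℚ.+ c ℚ.* Q)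
        ≡⟨ cong₂ ℚ._-_ (p≡0 n (ℕₚ.<⇒≤ N<n)) (p≡0 N ℕₚ.≤-refl) ⟩
      0ℚ ∎)
    where
    x = fromℕ n
    R = eval r (x ∷ [])
    Q = eval q (c ∷ [])

  coeff-r≡0 : ∀ i → coeff r (i ∷ []) ≡ 0ℚ
  coeff-r≡0 = eventually-zero⇒coeff≡0 m r
    (subst (_≤ m) (sym (length-quotient c q)) q≤m) (suc N) r≡0

  coeff-p≡0 : ∀ i → coeff (con a +X* q) (i ∷ []) ≡ 0ℚ
  -- The constant coefficient of `r` is q(N), which is therefore 0, and the value of a + x q at `N`
  -- reduces to `a`.
  coeff-p≡0 zero = begin
    a                             ≡⟨ ℚₚ.+-identityʳ a ⟨
    a ℚ.+ 0ℚ                      ≡⟨ cong (a ℚ.+_) (ℚₚ.*-zeroʳ c) ⟨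
    a ℚ.+ c ℚ.* 0ℚ                ≡⟨ cong (λ z → a ℚ.+ c ℚ.* z)
                                       (trans (sym (coeff-r≡0 0)) (coeff₀-quotient c q)) ⟩
    a ℚ.+ c ℚ.* eval q (c ∷ [])   ≡⟨ p≡0 N ℕₚ.≤-refl ⟩
    0ℚ                            ∎
  coeff-p≡0 (suc i) = begin
    coeff q (i ∷ [])              ≡⟨ ℚₚ.+-identityʳ _ ⟨
    coeff q (i ∷ []) ℚ.+ 0ℚ       ≡⟨ cong (coeff q (i ∷ []) ℚ.+_) (ℚₚ.*-zeroʳ c) ⟨
    coeff q (i ∷ []) ℚ.+ c ℚ.* 0ℚ ≡⟨ cong (λ z → coeff q (i ∷ []) ℚ.+ c ℚ.* z)
                                       (coeff-r≡0 (suc i)) ⟨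
    coeff q (i ∷ []) ℚ.+ c ℚ.* coeff r (suc i ∷ [])
                                  ≡⟨ coeff-quotient c q i ⟨
    coeff r (i ∷ [])              ≡⟨ coeff-r≡0 i ⟩
    0ℚ                            ∎

agree-on-ℕ⇒coeff≡ : ∀ p q →
  (∀ n → eval p (fromℕ n ∷ []) ≡ eval q (fromℕ n ∷ [])) →
  ∀ i → coeff p (i ∷ []) ≡ coeff q (i ∷ [])
agree-on-ℕ⇒coeff≡ p q p≗q i = p-q≡0⇒p≡q (coeff p (i ∷ [])) (coeff q (i ∷ [])) (begin
  coeff p (i ∷ []) ℚ.- coeff q (i ∷ [])
    ≡⟨ minus (coeff p (i ∷ [])) (coeff q (i ∷ [])) ⟨
  coeff p (i ∷ []) ℚ.+ ℚ.- 1ℚ ℚ.* coeff q (i ∷ [])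
    ≡⟨ cong (coeff p (i ∷ []) ℚ.+_) (coeff-*ᴾ (ℚ.- 1ℚ) q (i ∷ [])) ⟨
  coeff p (i ∷ []) ℚ.+ coeff (ℚ.- 1ℚ *ᴾ q) (i ∷ [])
    ≡⟨ coeff-+ᴾ p (ℚ.- 1ℚ *ᴾ q) (i ∷ []) ⟨
  coeff r (i ∷ [])
    ≡⟨ eventually-zero⇒coeff≡0 (length r) r ℕₚ.≤-refl 0 (λ n _ → r≡0 (fromℕ n ∷ []) (p≗q n)) i ⟩
  0ℚ ∎)
  where
  open ≡-Reasoning
  r = p +ᴾ (ℚ.- 1ℚ *ᴾ q)
  minus : ∀ a b → a ℚ.+ ℚ.- 1ℚ ℚ.* b ≡ a ℚ.- b
  minus = solve 2 (λ a b → a :+ (:- con 1ℚ) :* b := a :- b) refl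
  r≡0 : ∀ x → eval p x ≡ eval q x → eval r x ≡ 0ℚ
  r≡0 x eq = begin
    eval r x                           ≡⟨ eval-+ᴾ p (ℚ.- 1ℚ *ᴾ q) x ⟩
    eval p x ℚ.+ eval (ℚ.- 1ℚ *ᴾ q) x  ≡⟨ cong₂ ℚ._+_ eq (eval-*ᴾ (ℚ.- 1ℚ) q x) ⟩
    eval q x ℚ.+ ℚ.- 1ℚ ℚ.* eval q x   ≡⟨ minus (eval q x) (eval q x) ⟩
    eval q x ℚ.- eval q x              ≡⟨ ℚₚ.+-inverseʳ (eval q x) ⟩
    0ℚ                                 ∎

-- Finite sums

sumℚ-++ : ∀ xs ys → sumℚ (xs ++ ys) ≡ sumℚ xs ℚ.+ sumℚ ys
sumℚ-++ []       ys = sym (ℚₚ.+-identityˡ _)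
sumℚ-++ (x ∷ xs) ys = trans (cong (x ℚ.+_) (sumℚ-++ xs ys)) (sym (ℚₚ.+-assoc x _ _))

sumℚ-map-+ : ∀ (f g : A → ℚ) xs →
  sumℚ (map (λ x → f x ℚ.+ g x) xs) ≡ sumℚ (map f xs) ℚ.+ sumℚ (map g xs)
sumℚ-map-+ f g []       = refl
sumℚ-map-+ f g (x ∷ xs) = trans (cong (f x ℚ.+ g x ℚ.+_) (sumℚ-map-+ f g xs))
  (solve 4 (λ a b c d → a :+ b :+ (c :+ d) := (a :+ c) :+ (b :+ d)) refl
    (f x) (g x) (sumℚ (map f xs)) (sumℚ (map g xs)))

sumℚ-map-* : ∀ c (f : A → ℚ) xs →
  sumℚ (map (λ x → c ℚ.* f x) xs) ≡ c ℚ.* sumℚ (map f xs)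
sumℚ-map-* c f []       = sym (ℚₚ.*-zeroʳ c)
sumℚ-map-* c f (x ∷ xs) = trans (cong (c ℚ.* f x ℚ.+_) (sumℚ-map-* c f xs))
  (sym (ℚₚ.*-distribˡ-+ c (f x) _))

sumℚ-map-0 : ∀ (xs : List A) → sumℚ (map (λ _ → 0ℚ) xs) ≡ 0ℚ
sumℚ-map-0 []       = refl
sumℚ-map-0 (x ∷ xs) = trans (ℚₚ.+-identityˡ _) (sumℚ-map-0 xs)

sumℚ-map-cong : ∀ {f g : A → ℚ} → (∀ x → f x ≡ g x) → ∀ xs →
  sumℚ (map f xs) ≡ sumℚ (map g xs)
sumℚ-map-cong f≗g xs = cong sumℚ (Listₚ.map-cong f≗g xs)

sumℚ-filter : ∀ {P : Pred A 0ℓ} (P? : Decidable P) (f : A → ℚ) xs →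
  sumℚ (map f (List.filter P? xs)) ≡
  sumℚ (map (λ x → if does (P? x) then f x else 0ℚ) xs)
sumℚ-filter P? f [] = refl
sumℚ-filter P? f (x ∷ xs) with does (P? x)
... | true  = cong (f x ℚ.+_) (sumℚ-filter P? f xs)
... | false = trans (sumℚ-filter P? f xs) (sym (ℚₚ.+-identityˡ _))

-- Stated for an arbitrary `h` because the recursion of `applyUpTo` shifts `h` to `h ∘ suc`; `upTo`
-- is the case of the identity.
sumℚ-cartesianProductWith : ∀ {C : Set} (g : C → ℚ) (_∙_ : A → B → C) (h : ℕ → A) m ys →
  sumℚ (map g (List.cartesianProductWith _∙_ (List.applyUpTo h m) ys)) ≡
  sumℚ (List.applyUpTo (λ a → sumℚ (map (λ y → g (h a ∙ y)) ys)) m)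
sumℚ-cartesianProductWith g _∙_ h zero    ys = refl
sumℚ-cartesianProductWith g _∙_ h (suc m) ys = begin
  sumℚ (map g (map (h 0 ∙_) ys ++ zs))
    ≡⟨ cong sumℚ (Listₚ.map-++ g (map (h 0 ∙_) ys) zs) ⟩
  sumℚ (map g (map (h 0 ∙_) ys) ++ map g zs)
    ≡⟨ sumℚ-++ (map g (map (h 0 ∙_) ys)) (map g zs) ⟩
  sumℚ (map g (map (h 0 ∙_) ys)) ℚ.+ sumℚ (map g zs)
    ≡⟨ cong₂ ℚ._+_ (cong sumℚ (sym (Listₚ.map-∘ ys)))
         (sumℚ-cartesianProductWith g _∙_ (h ∘ suc) m ys) ⟩
  _ ∎
  where
  open ≡-Reasoning
  zs = List.cartesianProductWith _∙_ (List.applyUpTo (h ∘ suc) m) ys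

sumℚ-applyUpTo-0 : ∀ m (f : ℕ → ℚ) → (∀ a → f a ≡ 0ℚ) → sumℚ (List.applyUpTo f m) ≡ 0ℚ
sumℚ-applyUpTo-0 zero    f f≡0 = refl
sumℚ-applyUpTo-0 (suc m) f f≡0 =
  trans (cong₂ ℚ._+_ (f≡0 0) (sumℚ-applyUpTo-0 m (f ∘ suc) (f≡0 ∘ suc))) refl

-- Alternating sums over subsets

sign : Subset k → ℚ
sign {k} J = pow ℚ.+-*-rawSemiring (ℚ.- 1ℚ) (k ℕ.∸ ∣ J ∣)

alternating : (Subset k → ℚ) → ℚ
alternating {k} f = sumℚ (map (λ J → sign J ℚ.* f J) (subsets k))

alternating-cong : {f g : Subset k → ℚ} → (∀ J → f J ≡ g J) → alternating f ≡ alternating g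
alternating-cong {k} f≗g = sumℚ-map-cong (λ J → cong (sign J ℚ.*_) (f≗g J)) (subsets k)

alternating-+ : ∀ (f g : Subset k → ℚ) →
  alternating (λ J → f J ℚ.+ g J) ≡ alternating f ℚ.+ alternating g
alternating-+ {k} f g = trans
  (sumℚ-map-cong (λ J → ℚₚ.*-distribˡ-+ (sign J) (f J) (g J)) (subsets k))
  (sumℚ-map-+ (λ J → sign J ℚ.* f J) (λ J → sign J ℚ.* g J) (subsets k))

alternating-* : ∀ c (f : Subset k → ℚ) →
  alternating (λ J → c ℚ.* f J) ≡ c ℚ.* alternating f
alternating-* {k} c f = trans
  (sumℚ-map-cong (λ J →
    solve 3 (λ s c f → s :* (c :* f) := c :* (s :* f)) refl (sign J) c (f J)) (subsets k))
  (sumℚ-map-* c (λ J → sign J ℚ.* f J) (subsets k))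

-- The truncated subtraction in the exponent is a true one because |J| ≤ k. The counterpart for
-- `inside` holds by computation.
sign-outside : (J : Subset k) → sign (outside ∷ J) ≡ ℚ.- 1ℚ ℚ.* sign J
sign-outside {k} J = cong (pow ℚ.+-*-rawSemiring (ℚ.- 1ℚ)) (ℕₚ.+-∸-assoc 1 (∣p∣≤n J))

-- Subsets with and without the first element are paired and carry opposite signs: the alternating
-- sum is an iterated difference, one coordinate at a time.
alternating-suc : ∀ (f : Subset (suc k) → ℚ) →
  alternating f ≡ alternating (λ J → f (inside ∷ J) ℚ.- f (outside ∷ J))
alternating-suc {k} f = begin
  sumℚ (map g (map (outside ∷_) Js ++ map (inside ∷_) Js))
    ≡⟨ cong sumℚ (Listₚ.map-++ g (map (outside ∷_) Js) (map (inside ∷_) Js)) ⟩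
  sumℚ (map g (map (outside ∷_) Js) ++ map g (map (inside ∷_) Js))
    ≡⟨ sumℚ-++ (map g (map (outside ∷_) Js)) (map g (map (inside ∷_) Js)) ⟩
  sumℚ (map g (map (outside ∷_) Js)) ℚ.+ sumℚ (map g (map (inside ∷_) Js))
    ≡⟨ cong₂ (λ xs ys → sumℚ xs ℚ.+ sumℚ ys) (Listₚ.map-∘ Js) (Listₚ.map-∘ Js) ⟨
  sumℚ (map (λ J → g (outside ∷ J)) Js) ℚ.+ sumℚ (map (λ J → g (inside ∷ J)) Js)
    ≡⟨ sumℚ-map-+ (λ J → g (outside ∷ J)) (λ J → g (inside ∷ J)) Js ⟨
  sumℚ (map (λ J → g (outside ∷ J) ℚ.+ g (inside ∷ J)) Js)
    ≡⟨ sumℚ-map-cong (λ J → trans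
         (cong (λ s → s ℚ.* f (outside ∷ J) ℚ.+ g (inside ∷ J)) (sign-outside J))
         (solve 3 (λ s a b → ((:- con 1ℚ) :* s) :* a :+ s :* b := s :* (b :- a)) refl
           (sign J) (f (outside ∷ J)) (f (inside ∷ J)))) Js ⟩
  alternating (λ J → f (inside ∷ J) ℚ.- f (outside ∷ J)) ∎
  where
  open ≡-Reasoning
  g : Subset (suc k) → ℚ
  g J = sign J ℚ.* f J
  Js = subsets k

eval-mixedEhrhart : ∀ (E : Subset k → Polynomial 1) x →
  eval (mixedEhrhartPolynomial E) (x ∷ []) ≡ alternating (λ J → eval (E J) (x ∷ []))
eval-mixedEhrhart {k} E x = go (subsets k)
  where
  go : ∀ Js →
    eval (List.foldr _+ᴾ_ 0ᴾ (map (λ J → sign J *ᴾ E J) Js)) (x ∷ []) ≡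
    sumℚ (map (λ J → sign J ℚ.* eval (E J) (x ∷ [])) Js)
  go []       = refl
  go (J ∷ Js) = trans
    (eval-+ᴾ (sign J *ᴾ E J) (List.foldr _+ᴾ_ 0ᴾ (map (λ J → sign J *ᴾ E J) Js)) (x ∷ []))
    (cong₂ ℚ._+_ (eval-*ᴾ (sign J) (E J) (x ∷ [])) (go Js))

-- The diagonal of the part of full support

infixr 7 X*_

X*_ : Polynomial 1 → Polynomial 1
X* p = con 0ℚ +X* p

-- fullSupport sends x^α to x^|α| if all entries of α are positive and to 0
-- otherwise; in fullSupportTail the first entry may also be 0.
fullSupport     : Polynomial k → Polynomial 1
fullSupportTail : Polynomial (suc k) → Polynomial 1

fullSupport (con c)  = con c +X* 0ᴾ
fullSupport 0ᴾ       = 0ᴾ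
fullSupport (p +X* q) = X* fullSupportTail q

fullSupportTail 0ᴾ        = 0ᴾ
fullSupportTail (p +X* q) = fullSupport p +ᴾ X* fullSupportTail q

eval-X* : ∀ p x → eval (X* p) (x ∷ []) ≡ x ℚ.* eval p (x ∷ [])
eval-X* p x = ℚₚ.+-identityˡ _

alternating-0 : ∀ k → alternating {k} (λ _ → 0ℚ) ≡ 0ℚ
alternating-0 k = trans (sumℚ-map-cong (λ J → ℚₚ.*-zeroʳ (sign J)) (subsets k))
  (sumℚ-map-0 (subsets k))

-- For F = p + x₁ q the difference between x₁ = x and x₁ = 0 is x q(x, ...): the part `p` free of x₁
-- cancels. In the tail version the first variable is already fixed at `x`, and only the others
-- alternate.
eval-fullSupport : ∀ (F : Polynomial k) x →
  eval (fullSupport F) (x ∷ []) ≡ alternating (λ J → eval F (at 0ℚ x J))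
eval-fullSupportTail : ∀ (F : Polynomial (suc k)) x →
  eval (fullSupportTail F) (x ∷ []) ≡ alternating (λ J → eval F (x ∷ at 0ℚ x J))

eval-fullSupport (con c) x =
  solve 2 (λ c x → c :+ x :* con 0ℚ := con 1ℚ :* c :+ con 0ℚ) refl c x
eval-fullSupport {suc k} 0ᴾ x = sym (trans
  (alternating-cong {k = suc k} {λ J → eval 0ᴾ (at 0ℚ x J)} {λ _ → 0ℚ} λ { (_ ∷ _) → refl })
  (alternating-0 (suc k)))
eval-fullSupport (p +X* q) x = begin
  eval (X* fullSupportTail q) (x ∷ [])
    ≡⟨ eval-X* (fullSupportTail q) x ⟩
  x ℚ.* eval (fullSupportTail q) (x ∷ [])
    ≡⟨ cong (x ℚ.*_) (eval-fullSupportTail q x) ⟩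
  x ℚ.* alternating (λ J → eval q (x ∷ at 0ℚ x J))
    ≡⟨ alternating-* x (λ J → eval q (x ∷ at 0ℚ x J)) ⟨
  alternating (λ J → x ℚ.* eval q (x ∷ at 0ℚ x J))
    ≡⟨ alternating-cong (λ J →
         solve 3 (λ a b c → b := (a :+ b) :- (a :+ con 0ℚ :* c)) refl
           (eval p (at 0ℚ x J)) (x ℚ.* eval q (x ∷ at 0ℚ x J))
           (eval q (0ℚ ∷ at 0ℚ x J))) ⟩
  alternating (λ J → eval (p +X* q) (x ∷ at 0ℚ x J) ℚ.- eval (p +X* q) (0ℚ ∷ at 0ℚ x J))
    ≡⟨ alternating-suc (λ J → eval (p +X* q) (at 0ℚ x J)) ⟨
  alternating (λ J → eval (p +X* q) (at 0ℚ x J)) ∎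
  where open ≡-Reasoning

eval-fullSupportTail {k} 0ᴾ x = sym (alternating-0 k)
eval-fullSupportTail (p +X* q) x = begin
  eval (fullSupport p +ᴾ X* fullSupportTail q) (x ∷ [])
    ≡⟨ eval-+ᴾ (fullSupport p) (X* fullSupportTail q) (x ∷ []) ⟩
  eval (fullSupport p) (x ∷ []) ℚ.+ eval (X* fullSupportTail q) (x ∷ [])
    ≡⟨ cong (eval (fullSupport p) (x ∷ []) ℚ.+_) (eval-X* (fullSupportTail q) x) ⟩
  eval (fullSupport p) (x ∷ []) ℚ.+ x ℚ.* eval (fullSupportTail q) (x ∷ [])
    ≡⟨ cong₂ (λ a b → a ℚ.+ x ℚ.* b) (eval-fullSupport p x) (eval-fullSupportTail q x) ⟩
  alternating (λ J → eval p (at 0ℚ x J)) ℚ.+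
    x ℚ.* alternating (λ J → eval q (x ∷ at 0ℚ x J))
    ≡⟨ cong (alternating (λ J → eval p (at 0ℚ x J)) ℚ.+_)
         (alternating-* x (λ J → eval q (x ∷ at 0ℚ x J))) ⟨
  alternating (λ J → eval p (at 0ℚ x J)) ℚ.+
    alternating (λ J → x ℚ.* eval q (x ∷ at 0ℚ x J))
    ≡⟨ alternating-+ (λ J → eval p (at 0ℚ x J)) (λ J → x ℚ.* eval q (x ∷ at 0ℚ x J)) ⟨
  alternating (λ J → eval (p +X* q) (x ∷ at 0ℚ x J)) ∎
  where open ≡-Reasoning

-- Sums over compositions

composition? : ∀ k i (α : Vec ℕ k) → Dec (Vecᴬ.All (1 ≤_) α × Vec.sum α ≡ i)
composition? k i α = Vecᴬ.all? (1 ℕₚ.≤?_) α ×-dec (Vec.sum α ℕₚ.≟ i)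

-- The filter becomes an indicator, and the box bound `N` is kept apart from the weight `i`, since
-- the induction lowers `i` while the box for the other entries stays.
compositionSum : ∀ k → ℕ → ℕ → (Vec ℕ k → ℚ) → ℚ
compositionSum k N i f =
  sumℚ (map (λ α → if does (composition? k i α) then f α else 0ℚ) (box k N))

-- The sum for the factor q of p + x₁ q: its coefficient index is one below the first entry of the
-- composition, so the test is made on `suc a` and `suc i`. The first entry has its own bound `M`.
compositionSumTail : ∀ k → ℕ → ℕ → ℕ → (Vec ℕ (suc k) → ℚ) → ℚ
compositionSumTail k M N i f = sumℚ (List.applyUpTo (λ a → sumℚ (map
  (λ β → if does (composition? (suc k) (suc i) (suc a ∷ β)) then f (a ∷ β) else 0ℚ)
  (box k N))) M)

compositionSum-none : ∀ k N i (f : Vec ℕ k → ℚ) (g : Vec ℕ k → Vec ℕ (suc k)) →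
  (∀ β → does (composition? (suc k) i (g β)) ≡ false) →
  sumℚ (map (λ β → if does (composition? (suc k) i (g β)) then f β else 0ℚ) (box k N)) ≡ 0ℚ
compositionSum-none k N i f g none = trans
  (sumℚ-map-cong (λ β → cong (if_then f β else 0ℚ) (none β)) (box k N))
  (sumℚ-map-0 (box k N))

not-composition-0 : ∀ a (β : Vec ℕ k) → does (composition? (suc k) 0 (suc a ∷ β)) ≡ false
not-composition-0 a β = Boolₚ.∧-zeroʳ _

compositionSum-step : ∀ k N i (F : Vec ℕ (suc k) → ℚ) →
  compositionSum (suc k) N i F ≡ sumℚ (List.applyUpTo (λ a → sumℚ (map
    (λ β → if does (composition? (suc k) i (suc a ∷ β)) then F (suc a ∷ β) else 0ℚ)
    (box k N))) N)
compositionSum-step k N i F = begin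
  compositionSum (suc k) N i F
    ≡⟨ sumℚ-cartesianProductWith
         (λ α → if does (composition? (suc k) i α) then F α else 0ℚ) _∷_ (λ a → a) (suc N)
         (box k N) ⟩
  -- For first entry 0 the test `1 ≤? 0` computes to `false`, so that slice is a sum of zeros; the
  -- other `N` values have the form `suc a`.
  sumℚ (map (λ _ → 0ℚ) (box k N)) ℚ.+ rest
    ≡⟨ cong (ℚ._+ rest) (sumℚ-map-0 (box k N)) ⟩
  0ℚ ℚ.+ rest
    ≡⟨ ℚₚ.+-identityˡ rest ⟩
  rest ∎
  where
  open ≡-Reasoning
  rest : ℚ
  rest = sumℚ (List.applyUpTo (λ a → sumℚ (map
    (λ β → if does (composition? (suc k) i (suc a ∷ β)) then F (suc a ∷ β) else 0ℚ)
    (box k N))) N)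

-- Splitting off the first entry a of a composition of i; the bounds i ≤ N and i < M
-- on the box ensure that no composition is cut off.
compositionSum-fullSupport : ∀ N i → i ≤ N → (F : Polynomial k) →
  compositionSum k N i (coeff F) ≡ coeff (fullSupport F) (i ∷ [])
compositionSumTail-fullSupport : ∀ M N i → i < M → i ≤ N → (F : Polynomial (suc k)) →
  compositionSumTail k M N i (coeff F) ≡ coeff (fullSupportTail F) (i ∷ [])

compositionSum-fullSupport N zero    i≤N (con c) = ℚₚ.+-identityʳ c
compositionSum-fullSupport N (suc i) i≤N (con c) = refl
compositionSum-fullSupport {suc k} N i i≤N 0ᴾ = trans (compositionSum-step k N i (coeff 0ᴾ))
  (sumℚ-applyUpTo-0 N _ λ a → trans
    (sumℚ-map-cong (λ β → Boolₚ.if-eta (does (composition? (suc k) i (suc a ∷ β)))) (box k N))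
    (sumℚ-map-0 (box k N)))
compositionSum-fullSupport {suc k} N zero i≤N (p +X* q) =
  trans (compositionSum-step k N 0 (coeff (p +X* q)))
    (sumℚ-applyUpTo-0 N _ λ a →
      compositionSum-none k N 0 (λ β → coeff q (a ∷ β)) (suc a ∷_) (not-composition-0 a))
compositionSum-fullSupport {suc k} N (suc i) i<N (p +X* q) =
  trans (compositionSum-step k N (suc i) (coeff (p +X* q)))
    (compositionSumTail-fullSupport N N i i<N (ℕₚ.<⇒≤ i<N) q)

compositionSumTail-fullSupport {k} M N i i<M i≤N 0ᴾ =
  sumℚ-applyUpTo-0 M _ λ a → trans
    (sumℚ-map-cong (λ β → Boolₚ.if-eta (does (composition? (suc k) (suc i) (suc a ∷ β))))
      (box k N))
    (sumℚ-map-0 (box k N))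
compositionSumTail-fullSupport {k} (suc M) N zero i<M i≤N (p +X* q) = trans
  -- In the slice a = 0 the first entry is 1, which uses up the extra 1 in the weight and leaves a
  -- sum over compositions for `p`.
  (cong₂ ℚ._+_ (compositionSum-fullSupport N 0 i≤N p)
    (sumℚ-applyUpTo-0 M _ λ a →
      -- Testing a first entry `suc (suc a)` against weight 1 computes to the same Boolean as
      -- testing `suc a` against weight 0.
      compositionSum-none k N 1 (λ β → coeff q (a ∷ β)) (suc (suc a) ∷_)
        (not-composition-0 a)))
  (sym (coeff-+ᴾ (fullSupport p) (X* fullSupportTail q) (0 ∷ [])))
compositionSumTail-fullSupport (suc M) N (suc i) (s≤s i<M) i≤N (p +X* q) = trans
  (cong₂ ℚ._+_ (compositionSum-fullSupport N (suc i) i≤N p)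
    -- The slices with a at least 1 form the tail sum for `q`, with `M` and the weight both lowered
    -- by one.
    (compositionSumTail-fullSupport M N i i<M (ℕₚ.<⇒≤ i≤N) q))
  (sym (coeff-+ᴾ (fullSupport p) (X* fullSupportTail q) (suc i ∷ [])))

-- `composition?` is the test by which `compositions` filters the box, whose bound is N = i.
coeff-fullSupport-compositions : ∀ k i (F : Polynomial k) →
  coeff (fullSupport F) (i ∷ []) ≡ sumℚ (map (coeff F) (compositions k i))
coeff-fullSupport-compositions k i F = sym (trans
  (sumℚ-filter (composition? k i) (coeff F) (box k i))
  (compositionSum-fullSupport i i ℕₚ.≤-refl F))

-- Each variable contributes a factor X, so `fullSupport F` is divisible by the k-th power of X; the
-- tail version has one more variable, but that one may be absent.
coeff-fullSupport-< : ∀ i (F : Polynomial k) → i < k → coeff (fullSupport F) (i ∷ []) ≡ 0ℚ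
coeff-fullSupportTail-< : ∀ i (F : Polynomial (suc k)) → i < k →
  coeff (fullSupportTail F) (i ∷ []) ≡ 0ℚ
coeff-fullSupport-< i       0ᴾ        i<k       = refl
coeff-fullSupport-< zero    (p +X* q) i<k       = refl
coeff-fullSupport-< (suc i) (p +X* q) (s≤s i<k) = coeff-fullSupportTail-< i q i<k
coeff-fullSupportTail-< i       0ᴾ        i<k = refl
coeff-fullSupportTail-< zero    (p +X* q) i<k = trans
  (coeff-+ᴾ (fullSupport p) (X* fullSupportTail q) (0 ∷ []))
  (cong (ℚ._+ 0ℚ) (coeff-fullSupport-< 0 p i<k))
coeff-fullSupportTail-< (suc i) (p +X* q) i<k = trans
  (coeff-+ᴾ (fullSupport p) (X* fullSupportTail q) (suc i ∷ []))
  (cong₂ ℚ._+_ (coeff-fullSupport-< (suc i) p i<k)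
    (coeff-fullSupportTail-< i q (ℕₚ.<⇒≤ i<k)))

-- Restriction of the multivariate Ehrhart polynomial to n·1_J

map-fromℕ-at : ∀ n (J : Subset k) → Vec.map fromℕ (at 0 n J) ≡ at 0ℚ (fromℕ n) J
map-fromℕ-at n []            = refl
map-fromℕ-at n (inside ∷ J)  = cong (fromℕ n ∷_) (map-fromℕ-at n J)
map-fromℕ-at n (outside ∷ J) = cong (0ℚ ∷_) (map-fromℕ-at n J)

-- At n·1_J both polynomials count the lattice points of the same set, by the two inclusions for
-- dilates of Minkowski sums.
ehrhart-restriction : (P : Vector (Pred (Point d) 0ℓ) k) → (∀ j → IsLatticePolytope (P j)) →
  (F : Polynomial k) → IsMultivariateEhrhartPolynomial P F →
  ∀ J E → IsEhrhartPolynomial (minkowskiSum J P) E →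
  ∀ n → eval E (fromℕ n ∷ []) ≡ eval F (at 0ℚ (fromℕ n) J)
ehrhart-restriction {d} {k} P P-lattice F F-ehrhart J E E-ehrhart n = begin
  eval E (fromℕ n ∷ [])             ≡⟨ proj₂ (proj₂ S-count) ⟩
  fromℕ (proj₁ S-count)             ≡⟨ cong fromℕ (cardinality-unique S⇔T
                                         (proj₁ (proj₂ S-count)) (proj₁ (proj₂ T-count))) ⟩
  fromℕ (proj₁ T-count)             ≡⟨ proj₂ (proj₂ T-count) ⟨
  eval F (Vec.map fromℕ (at 0 n J)) ≡⟨ cong (eval F) (map-fromℕ-at n J) ⟩
  eval F (at 0ℚ (fromℕ n) J)        ∎
  where
  open ≡-Reasoning
  S T : Pred (Vec ℤ d) 0ℓ
  S = latticePoints (n • minkowskiSum J P)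
  T = latticePoints (minkowskiSum ⊤ (λ j → Vec.lookup (at 0 n J) j • P j))
  S-count : ∃[ c ] HasCardinality S c × eval E (fromℕ n ∷ []) ≡ fromℕ c
  S-count = E-ehrhart n
  T-count : ∃[ c ] HasCardinality T c × eval F (Vec.map fromℕ (at 0 n J)) ≡ fromℕ c
  T-count = IsMultivariateEhrhartPolynomial.counts F-ehrhart (at 0 n J)
  P-nonempty : ∀ j → ∃ (P j)
  P-nonempty j = polytope-nonempty (P j) (P-lattice j)
  S⇔T : ∀ z → S z ⇔ T z
  S⇔T z = mk⇔ (dilate-sum⁺ n J P P-nonempty (fromℤᵈ z)) (dilate-sum⁻ n J P (fromℤᵈ z))

theorem2p4 : (d k : ℕ) → 1 ≤ d → 1 ≤ k →
    (P : Vector (Pred (Point d) 0ℓ) k) →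
    (∀ j → IsLatticePolytope (P j)) →
    HasDimension (minkowskiSum ⊤ P) d →
    (E : Subset k → Polynomial 1) →
    (∀ J → IsEhrhartPolynomial (minkowskiSum J P) (E J)) →
    (F : Polynomial k) →
    IsMultivariateEhrhartPolynomial P F →
    (∀ i → i ≤ d →
    coeff (mixedEhrhartPolynomial E) (i ∷ []) ≡ sumℚ (map (coeff F) (compositions k i)))
    × (∀ i → i < k → coeff (mixedEhrhartPolynomial E) (i ∷ []) ≡ 0ℚ)
theorem2p4 d k _ _ P P-lattice _ E E-ehrhart F F-ehrhart =
    (λ i _ → trans (me≡ i) (coeff-fullSupport-compositions k i F))
  , (λ i i<k → trans (me≡ i) (coeff-fullSupport-< i F i<k))
  where
  -- Both claims are read off `fullSupport F`, which has the same values on `ℕ` as the mixed Ehrhart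
  -- polynomial.
  me≡ : ∀ i → coeff (mixedEhrhartPolynomial E) (i ∷ []) ≡ coeff (fullSupport F) (i ∷ [])
  me≡ = agree-on-ℕ⇒coeff≡ (mixedEhrhartPolynomial E) (fullSupport F) λ n → begin
    eval (mixedEhrhartPolynomial E) (fromℕ n ∷ [])
      ≡⟨ eval-mixedEhrhart E (fromℕ n) ⟩
    alternating (λ J → eval (E J) (fromℕ n ∷ []))
      ≡⟨ alternating-cong (λ J →
           ehrhart-restriction P P-lattice F F-ehrhart J (E J) (E-ehrhart J) n) ⟩
    alternating (λ J → eval F (at 0ℚ (fromℕ n) J))
      ≡⟨ eval-fullSupport F (fromℕ n) ⟨
    eval (fullSupport F) (fromℕ n ∷ []) ∎
    where open ≡-Reasoning
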